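{- For every prime power $q$, $$B(2,q)\ \ge\ q^2-\mathrm{Nikodym}(2,q).$$
   Context: $\mathrm{PG}(2,q)$ is the projective plane over $\mathbb{F}_q$. A set of points $B\subset\mathrm{PG}(2,q)$ is a blocking set if $\ell\cap B\ne\emptyset$ for every line $\ell$ of $\mathrm{PG}(2,q)$; it is a minimal blocking set if it is a blocking set and no proper subset of $B$ is a blocking set. $B(2,q)$ denotes the maximum cardinality of a minimal blocking set in $\mathrm{PG}(2,q)$. A set $N\subset\mathbb{F}_q^2$ is a Nikodym set if for every $x\in\mathbb{F}_q^2$ there exists $v\in\mathbb{F}_q^2\setminus\{0\}$ such that $\{x+tv: t\in\mathbb{F}_q\}\setminus\{x\}\subset N$. $\mathrm{Nikodym}(2,q)$ denotes the size of the smallest Nikodym set in $\mathbb{F}_q^2$. -}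

module Defs where

open import Algebra.Structures using (IsCommutativeRing)
open import Data.Fin.Base using (Fin)
open import Data.List.Base using (List; length)
open import Data.List.Relation.Unary.Any using (Any)
import Data.List.Membership.Propositional as Mem
import Data.List.Relation.Binary.Subset.Setoid as SubsetS
import Data.List.Relation.Unary.Unique.Propositional as UniqueP
import Data.List.Relation.Unary.Unique.Setoid as UniqueS
open import Data.Nat.Base as ℕ using (ℕ; _≤_; _≥_)
open import Data.Nat.Primality using (Prime)
open import Data.Product.Base using (Σ; ∃; ∃₂; _×_; _,_; proj₁)
open import Function.Bundles using (_↔_)
open import Level using (0ℓ)
open import Relation.Binary.Bundles using (Setoid)
open import Relation.Binary.PropositionalEquality
open import Relation.Nullary.Negation using (¬_)

IsPrimePower : ℕ → Set
IsPrimePower q = ∃₂ λ p k → Prime p × k ≥ 1 × q ≡ p ℕ.^ k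

IsMaximum : (ℕ → Set) → ℕ → Set
IsMaximum P m = P m × (∀ k → P k → k ≤ m)

IsMinimum : (ℕ → Set) → ℕ → Set
IsMinimum P m = P m × (∀ k → P k → m ≤ k)

-- A field with exactly q elements.  As 𝔽_q is unique only up to isomorphism,
-- "over 𝔽_q" is rendered as "over every F : FiniteField q".
record FiniteField (q : ℕ) : Set₁ where
  infixl 6 _+_
  infixl 7 _*_
  infix  8 -_
  field
    Carrier           : Set
    _+_ _*_           : Carrier → Carrier → Carrier
    -_                : Carrier → Carrier
    0# 1#             : Carrier
    isCommutativeRing : IsCommutativeRing _≡_ _+_ _*_ -_ 0# 1#
    1≢0               : 1# ≢ 0#
    inverse           : ∀ x → x ≢ 0# → ∃ λ y → x * y ≡ 1#
    finite            : Carrier ↔ Fin q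

  open IsCommutativeRing isCommutativeRing public
    using (*-assoc; *-comm; *-identityˡ; zeroˡ; zeroʳ)

module Projective {q : ℕ} (F : FiniteField q) where
  open FiniteField F

  Triple : Set
  Triple = Carrier × Carrier × Carrier

  infixr 7 _·_
  _·_ : Carrier → Triple → Triple
  c · (x , y , z) = c * x , c * y , c * z

  NonzeroTriple : Set
  NonzeroTriple = Σ Triple (_≢ (0# , 0# , 0#))

  infix 4 _∼_
  _∼_ : NonzeroTriple → NonzeroTriple → Set
  (u , _) ∼ (v , _) = ∃ λ c → c ≢ 0# × v ≡ c · u

  private
    triple≡ : ∀ {x x′ y y′ z z′ : Carrier} → x ≡ x′ → y ≡ y′ → z ≡ z′ →
              _≡_ {A = Triple} (x , y , z) (x′ , y′ , z′)
    triple≡ refl refl refl = refl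

    ·-identity : ∀ v → 1# · v ≡ v
    ·-identity (x , y , z) =
      triple≡ (*-identityˡ x) (*-identityˡ y) (*-identityˡ z)

    ·-assoc : ∀ c d v → (c * d) · v ≡ c · d · v
    ·-assoc c d (x , y , z) =
      triple≡ (*-assoc c d x) (*-assoc c d y) (*-assoc c d z)

    unit≢0 : ∀ {c d} → c * d ≡ 1# → c ≢ 0#
    unit≢0 {d = d} cd≡1 c≡0 =
      1≢0 (trans (sym cd≡1) (trans (cong (_* d) c≡0) (zeroˡ d)))

    *-nonzero : ∀ {c d} → c ≢ 0# → d ≢ 0# → c * d ≢ 0#
    *-nonzero {c} {d} c≢0 d≢0 cd≡0 with inverse c c≢0
    ... | e , ce≡1 = d≢0 (begin
      d            ≡⟨ *-identityˡ d ⟨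
      1# * d       ≡⟨ cong (_* d) (trans (*-comm e c) ce≡1) ⟨
      (e * c) * d  ≡⟨ *-assoc e c d ⟩
      e * (c * d)  ≡⟨ cong (e *_) cd≡0 ⟩
      e * 0#       ≡⟨ zeroʳ e ⟩
      0#           ∎)
      where open ≡-Reasoning

    ∼-refl : ∀ {u} → u ∼ u
    ∼-refl {u , _} = 1# , 1≢0 , sym (·-identity u)

    ∼-sym : ∀ {u v} → u ∼ v → v ∼ u
    ∼-sym {u , _} {v , _} (c , c≢0 , v≡cu) with inverse c c≢0
    ... | d , cd≡1 = d , unit≢0 dc≡1 , (begin
      u            ≡⟨ ·-identity u ⟨
      1# · u       ≡⟨ cong (_· u) dc≡1 ⟨
      (d * c) · u  ≡⟨ ·-assoc d c u ⟩
      d · c · u    ≡⟨ cong (d ·_) v≡cu ⟨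
      d · v        ∎)
      where
      open ≡-Reasoning
      dc≡1 = trans (*-comm d c) cd≡1

    ∼-trans : ∀ {u v w} → u ∼ v → v ∼ w → u ∼ w
    ∼-trans {u , _} (c , c≢0 , v≡cu) (d , d≢0 , w≡dv) =
      d * c , *-nonzero d≢0 c≢0 ,
      trans w≡dv (trans (cong (d ·_) v≡cu) (sym (·-assoc d c u)))

  -- The points of PG(2,q): nonzero homogeneous coordinates up to scaling.
  PG : Setoid 0ℓ 0ℓ
  PG = record
    { Carrier       = NonzeroTriple
    ; _≈_           = _∼_
    ; isEquivalence = record
      { refl  = λ {u} → ∼-refl {u}
      ; sym   = λ {u} {v} → ∼-sym {u} {v}
      ; trans = λ {u} {v} {w} → ∼-trans {u} {v} {w}
      }
    }

  open Setoid PG public using () renaming (Carrier to Point)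
  open SubsetS PG public using (_⊆_; _⊈_)
  open UniqueS PG public using (Unique)

  -- (a , b , c) stands for the line a x + b y + c z = 0; proportional triples
  -- give the same line, which does not affect quantification over all lines.
  Line : Set
  Line = NonzeroTriple

  infix 4 _on_
  _on_ : Point → Line → Set
  ((x , y , z) , _) on ((a , b , c) , _) = a * x + b * y + c * z ≡ 0#

  -- A set of points is given by a list of its elements; its cardinality is the
  -- length of a list that is Unique (pairwise non-proportional).
  IsBlockingSet : List Point → Set
  IsBlockingSet B = (ℓ : Line) → Any (_on ℓ) B

  IsMinimalBlockingSet : List Point → Set
  IsMinimalBlockingSet B =
    IsBlockingSet B × (∀ C → C ⊆ B → B ⊈ C → ¬ IsBlockingSet C)

  -- IsB b  means  B(2,q) = b.
  IsB : ℕ → Set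
  IsB = IsMaximum λ k →
    ∃ λ B → Unique B × IsMinimalBlockingSet B × length B ≡ k

module Affine {q : ℕ} (F : FiniteField q) where
  open FiniteField F

  Pair : Set
  Pair = Carrier × Carrier

  infixl 6 _⊕_
  _⊕_ : Pair → Pair → Pair
  (x , y) ⊕ (x′ , y′) = x + x′ , y + y′

  infixr 7 _·_
  _·_ : Carrier → Pair → Pair
  c · (x , y) = c * x , c * y

  open Mem using (_∈_)
  open UniqueP using (Unique)

  IsNikodymSet : List Pair → Set
  IsNikodymSet N =
    ∀ x → ∃ λ v → v ≢ (0# , 0#) × (∀ t → x ⊕ t · v ≢ x → x ⊕ t · v ∈ N)

  -- IsNikodym n  means  Nikodym(2,q) = n.
  IsNikodym : ℕ → Set
  IsNikodym = IsMinimum λ k →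
    ∃ λ N → Unique N × IsNikodymSet N × length N ≡ k

open Projective public using (IsB)
open Affine public using (IsNikodym)

-- Dually, a set of lines is blocking when every point lies on one of its lines.
-- Given a Nikodym set N, the line at infinity together with one Nikodym line
-- through each affine point is such a set, and so is some minimal subset M of it.
-- A Nikodym line contains at most one affine point outside N, so sending an affine
-- point outside N to a line of M through it is injective; hence |M| ≥ q² − |N|.

{-# OPTIONS --safe #-}
module Submission where

open import Defs
open import Data.Nat.Base using (ℕ; _≥_; _∸_; _^_)

open import Algebra.Bundles using (CommutativeRing)
import Algebra.Properties.Ring as RingProperties
import Algebra.Solver.Ring.NaturalCoefficients.Default as SemiringSolver
open import Data.Fin.Base using (Fin; zero; suc)
import Data.Fin.Properties as Fin
open import Data.List.Base using (List; []; _∷_; length; lookup; removeAt; tabulate)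
import Data.List.Membership.DecPropositional as DecMembership
open import Data.List.Membership.Propositional using (lose)
open import Data.List.Membership.Propositional.Properties using (∈-lookup)
open import Data.List.Membership.Setoid using (find)
open import Data.List.Membership.Setoid.Properties using (∈-resp-≈)
open import Data.List.Properties using (length-removeAt′; tabulate-lookup)
open import Data.List.Relation.Unary.All as All using (All; []; _∷_)
import Data.List.Relation.Unary.All.Properties as All
import Data.List.Relation.Unary.AllPairs.Properties as AllPairs
open import Data.List.Relation.Unary.Any as Any using (Any; here; there; index)
import Data.List.Relation.Unary.Any.Properties as Any
import Data.Nat.Base as ℕ
import Data.Nat.Properties as ℕ
open import Data.Product.Base using (∃; _×_; _,_; proj₁; proj₂)
open import Data.Product.Function.NonDependent.Propositional using (_×-↔_)
open import Data.Product.Properties using (≡-dec)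
open import Data.Sum.Base using (_⊎_; inj₁; inj₂)
open import Data.Sum.Properties using (inj₁-injective; inj₂-injective)
open import Function.Base using (_∘_)
open import Function.Bundles using (_↔_; module Injection; module Inverse)
open import Function.Construct.Composition using (_↔-∘_)
open import Function.Construct.Symmetry using (↔-sym)
open import Function.Properties.Inverse using (↔⇒↣)
open import Level using (Level; 0ℓ)
open import Relation.Binary.Definitions using (DecidableEquality)
open import Relation.Binary.PropositionalEquality
open import Relation.Nullary.Decidable using (decidable-stable; yes; no)
open import Relation.Nullary.Negation using (¬_; contradiction)

-- Lists irreducible under deletion of an entry

private
  variable
    a p : Level
    A : Set a
    P : A → Set p

Any-removeAt⁺ : ∀ (xs : List A) {i j} → i ≢ j → P (lookup xs j) → Any P (removeAt xs i)
Any-removeAt⁺ (x ∷ xs) {zero}  {zero}  i≢j pj = contradiction refl i≢j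
Any-removeAt⁺ (x ∷ xs) {zero}  {suc j} i≢j pj = lose (∈-lookup j) pj
Any-removeAt⁺ (x ∷ xs) {suc i} {zero}  i≢j pj = here pj
Any-removeAt⁺ (x ∷ xs) {suc i} {suc j} i≢j pj = there (Any-removeAt⁺ xs (i≢j ∘ cong suc) pj)

All-removeAt⁺ : ∀ {xs : List A} i → All P xs → All P (removeAt xs i)
All-removeAt⁺ zero    (px ∷ pxs) = pxs
All-removeAt⁺ (suc i) (px ∷ pxs) = px ∷ All-removeAt⁺ i pxs

-- The list is finite, so the double negations can be opened one entry at a time.
All-¬¬-pull : ∀ (xs : List A) → (∀ i → ¬ ¬ P (lookup xs i)) → ¬ ¬ All P xs
All-¬¬-pull []       ¬¬p ¬all = ¬all []
All-¬¬-pull (x ∷ xs) ¬¬p ¬all =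
  ¬¬p zero λ px → All-¬¬-pull xs (¬¬p ∘ suc) λ pxs → ¬all (px ∷ pxs)

-- Deletion is by position, so irreducibility of a blocking list also excludes repeated points.
Irreducible : (List A → Set p) → List A → Set p
Irreducible Q xs = ∀ i → ¬ Q (removeAt xs i)

-- The double negation dispenses with deciding Q; it is removed at the end, where
-- the goal is a decidable inequality.
irreducible-sublist : ∀ {P : A → Set p} {Q : List A → Set p} xs → All P xs → Q xs →
                      ¬ ¬ ∃ λ ys → All P ys × Q ys × Irreducible Q ys
irreducible-sublist {P = P} {Q = Q} xs = go (length xs) xs ℕ.≤-refl
  where
  go : ∀ n xs → length xs ℕ.≤ n → All P xs → Q xs →
       ¬ ¬ ∃ λ ys → All P ys × Q ys × Irreducible Q ys
  go ℕ.zero    []         _    pxs qxs k = k ([] , pxs , qxs , λ ())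
  -- `xs` itself is offered to `k`; if some deletion still satisfies `Q`, that shorter list is
  -- treated with the same `k`.
  go (ℕ.suc n) xs         xs≤n pxs qxs k = k (xs , pxs , qxs , λ i q →
    go n (removeAt xs i)
       (ℕ.s≤s⁻¹ (subst (ℕ._≤ ℕ.suc n) (length-removeAt′ xs i) xs≤n))
       (All-removeAt⁺ i pxs) q k)

module _ {q : ℕ} (F : FiniteField q) where
  open FiniteField F using (inverse; finite; 1≢0)
  open Projective F hiding (_·_)
  open Affine F using (Pair; _⊕_; _·_; IsNikodymSet)

  private
    ring : CommutativeRing 0ℓ 0ℓ
    ring = record { isCommutativeRing = FiniteField.isCommutativeRing F }

  open CommutativeRing ring hiding (ring; refl; sym; trans; isCommutativeRing; zero)
  open RingProperties (CommutativeRing.ring ring)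
  open SemiringSolver commutativeSemiring using (solve; _:=_; _:+_; _:*_; con)

  private
    _≟_ : DecidableEquality Carrier
    _≟_ = Fin.inj⇒≟ (↔⇒↣ finite)

  open DecMembership (≡-dec _≟_ _≟_) using (_∈_; _∉_; _∈?_)

  pairs : Pair ↔ Fin (q ℕ.* q)
  pairs = ↔-sym Fin.*↔× ↔-∘ (finite ×-↔ finite)

  -- Homogeneity of incidence

  dot-scaleˡ : ∀ k a b c x y z →
    k * a * x + k * b * y + k * c * z ≡ k * (a * x + b * y + c * z)
  dot-scaleˡ = solve 7 (λ k a b c x y z →
    k :* a :* x :+ k :* b :* y :+ k :* c :* z := k :* (a :* x :+ b :* y :+ c :* z))
    refl

  dot-scaleʳ : ∀ k a b c x y z →
    a * (k * x) + b * (k * y) + c * (k * z) ≡ k * (a * x + b * y + c * z)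
  dot-scaleʳ = solve 7 (λ k a b c x y z →
    a :* (k :* x) :+ b :* (k :* y) :+ c :* (k :* z) := k :* (a :* x :+ b :* y :+ c :* z))
    refl

  on-resp-∼ : ∀ {P P′} ℓ → P ∼ P′ → P on ℓ → P′ on ℓ
  on-resp-∼ {(x , y , z) , _} {_} ((a , b , c) , _) (k , _ , refl) P-on =
    trans (dot-scaleʳ k a b c x y z) (trans (cong (k *_) P-on) (zeroʳ k))

  -- Irreducible blocking lists

  blocking-off-index : ∀ B {i} → (∀ ℓ → ∃ λ j → i ≢ j × lookup B j on ℓ) →
                       IsBlockingSet (removeAt B i)
  blocking-off-index B f ℓ with f ℓ
  ... | j , i≢j , j-on = Any-removeAt⁺ B i≢j j-on

  -- If the entries at `i` and `j` were proportional, the latter could replace the former on every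
  -- line, and entry `i` could be deleted.
  irreducible⇒unique : ∀ B → IsBlockingSet B → Irreducible IsBlockingSet B → Unique B
  irreducible⇒unique B blocking irreducible =
    subst Unique (tabulate-lookup B) (AllPairs.tabulate⁺ λ {i} {j} i≢j i∼j →
      irreducible i (blocking-off-index B λ ℓ → avoid i≢j i∼j ℓ (blocking ℓ)))
    where
    avoid : ∀ {i j} → i ≢ j → lookup B i ∼ lookup B j → ∀ ℓ → Any (_on ℓ) B →
            ∃ λ k → i ≢ k × lookup B k on ℓ
    avoid {i} {j} i≢j i∼j ℓ any with i Fin.≟ index any
    ... | yes i≡k = j , i≢j , on-resp-∼ {lookup B i} {lookup B j} ℓ i∼j
                      (subst (λ k → lookup B k on ℓ) (sym i≡k) (Any.lookup-index any))
    ... | no  i≢k = index any , i≢k , Any.lookup-index any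

  -- If a blocking `C ⊆ B` missed the entry at `i`, the points of `C` would be represented in `B` at
  -- other indices, so `B` would still block without entry `i`. Hence no entry is missed, up to
  -- double negation, which suffices to refute `B ⊈ C`.
  irreducible⇒minimal : ∀ B → IsBlockingSet B → Irreducible IsBlockingSet B →
                        IsMinimalBlockingSet B
  irreducible⇒minimal B blocking irreducible = blocking , λ C C⊆B B⊈C C-blocking →
    All-¬¬-pull B
      (λ i i∉C → irreducible i (blocking-off-index B λ ℓ →
        let c , c∈C , c-on = find PG (C-blocking ℓ)
            c∈B = C⊆B {c} c∈C
            c∼  = Any.lookup-index c∈B
        in index c∈B
         , (λ i≡k → i∉C (subst (λ k → Any (lookup B k ∼_) C) (sym i≡k)
             (∈-resp-≈ PG {x = c} {lookup B (index c∈B)} c∼ c∈C)))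
         , on-resp-∼ {c} {lookup B (index c∈B)} ℓ c∼ c-on))
      (λ B⊆C → B⊈C λ {x} x∈B →
        All.lookupₛ PG (λ {y} {z} → ∈-resp-≈ PG {x = y} {z}) B⊆C {x} x∈B)

  -- Affine lines as dual points

  proportional-v₁≢0 : ∀ {v₁ v₂ d₁ d₂} → v₁ ≢ 0# → d₁ * v₂ ≡ d₂ * v₁ →
                  ∃ λ t → t * v₁ ≡ d₁ × t * v₂ ≡ d₂
  proportional-v₁≢0 {v₁} {v₂} {d₁} {d₂} v₁≢0 d₁v₂≡d₂v₁ with inverse v₁ v₁≢0
  ... | u , v₁u≡1 = d₁ * u , cancel d₁ , (begin
    d₁ * u * v₂  ≡⟨ swap d₁ u v₂ ⟩
    d₁ * v₂ * u  ≡⟨ cong (_* u) d₁v₂≡d₂v₁ ⟩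
    d₂ * v₁ * u  ≡⟨ swap d₂ v₁ u ⟩
    d₂ * u * v₁  ≡⟨ cancel d₂ ⟩
    d₂           ∎)
    where
    open ≡-Reasoning
    swap : ∀ x y z → x * y * z ≡ x * z * y
    swap = solve 3 (λ x y z → x :* y :* z := x :* z :* y) refl
    cancel : ∀ d → d * u * v₁ ≡ d
    cancel d = begin
      d * u * v₁    ≡⟨ swap d u v₁ ⟩
      d * v₁ * u    ≡⟨ *-assoc d v₁ u ⟩
      d * (v₁ * u)  ≡⟨ cong (d *_) v₁u≡1 ⟩
      d * 1#        ≡⟨ *-identityʳ d ⟩
      d             ∎

  proportional : ∀ {v₁ v₂ d₁ d₂} → (v₁ , v₂) ≢ (0# , 0#) → d₁ * v₂ ≡ d₂ * v₁ →
                 ∃ λ t → t * v₁ ≡ d₁ × t * v₂ ≡ d₂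
  proportional {v₁} {v₂} v≢0 eq with v₁ ≟ 0#
  ... | no  v₁≢0 = proportional-v₁≢0 v₁≢0 eq
  -- Here the second coordinate of `v` is nonzero, so the same argument runs with the coordinates
  -- exchanged.
  ... | yes refl with proportional-v₁≢0 (λ v₂≡0 → v≢0 (cong (0# ,_) v₂≡0)) (sym eq)
  ...   | t , tv₂≡d₂ , tv₁≡d₁ = t , tv₁≡d₁ , tv₂≡d₂

  -- Points and lines are swapped: an affine point (x , y) becomes the dual line
  -- [x : y : 1], and the affine line through it in direction v a dual point.
  homogenize : Pair → Line
  homogenize (x , y) = (x , y , 1#) , λ eq → 1≢0 (cong (proj₂ ∘ proj₂) eq)

  -- With `u` the inverse of `c`, the triple (a, b, c) is `c` times (ua, ub, 1).
  on-dehomogenize : ∀ P (ℓ@((a , b , c) , _) : Line) {u} → c * u ≡ 1# →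
                    P on homogenize (u * a , u * b) → P on ℓ
  on-dehomogenize ((x , y , z) , _) ((a , b , c) , _) {u} cu≡1 P-on = begin
    a * x + b * y + c * z                           ≡⟨ cong₂ _+_
                                                         (cong₂ _+_ (rescale a x) (rescale b y))
                                                         (cong (_* z) (sym (*-identityʳ c))) ⟩
    c * (u * a) * x + c * (u * b) * y + c * 1# * z  ≡⟨ dot-scaleˡ c (u * a) (u * b) 1# x y z ⟩
    c * (u * a * x + u * b * y + 1# * z)            ≡⟨ cong (c *_) P-on ⟩
    c * 0#                                          ≡⟨ zeroʳ c ⟩
    0#                                              ∎
    where
    open ≡-Reasoning
    rescale : ∀ d e → d * e ≡ c * (u * d) * e
    rescale d e = cong (_* e) (begin
      d            ≡⟨ *-identityˡ d ⟨
      1# * d       ≡⟨ cong (_* d) cu≡1 ⟨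
      c * u * d    ≡⟨ *-assoc c u d ⟩
      c * (u * d)  ∎)

  joining : Pair → (v : Pair) → v ≢ (0# , 0#) → Point
  joining (x , y) (v₁ , v₂) v≢0 =
    -- The normal vector (v₂, -v₁) is orthogonal to the direction; the constant term makes the line
    -- pass through (x, y).
    (v₂ , - v₁ , - x * v₂ + - y * - v₁) ,
    λ eq → v≢0 (cong₂ _,_ (-‿injective (trans (cong (proj₁ ∘ proj₂) eq) (sym -0#≈0#)))
                          (cong proj₁ eq))

  line-at-infinity : Point
  line-at-infinity = (0# , 0# , 1#) , λ eq → 1≢0 (cong (proj₂ ∘ proj₂) eq)

  -- The right-hand side is the determinant of displacement and direction. The identity holds with
  -- arbitrary elements for `- x`, `- y` and `- v₁`, so a semiring solver can treat these as atoms.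
  joining-dot : ∀ x y v₁ v₂ x′ y′ →
    x′ * v₂ + y′ * - v₁ + 1# * (- x * v₂ + - y * - v₁) ≡ (x′ - x) * v₂ + (y′ - y) * - v₁
  joining-dot x y v₁ v₂ x′ y′ = solve 6 (λ nx ny w v₂ x′ y′ →
    x′ :* v₂ :+ y′ :* w :+ con 1 :* (nx :* v₂ :+ ny :* w) :=
    (x′ :+ nx) :* v₂ :+ (y′ :+ ny) :* w) refl (- x) (- y) (- v₁) v₂ x′ y′

  base-on-joining : ∀ x v v≢0 → joining x v v≢0 on homogenize x
  base-on-joining (x , y) (v₁ , v₂) v≢0 = begin
    x * v₂ + y * - v₁ + 1# * (- x * v₂ + - y * - v₁)  ≡⟨ joining-dot x y v₁ v₂ x y ⟩
    (x - x) * v₂ + (y - y) * - v₁                     ≡⟨ cong₂ (λ a b → a * v₂ + b * - v₁)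
                                                           (-‿inverseʳ x) (-‿inverseʳ y) ⟩
    0# * v₂ + 0# * - v₁                               ≡⟨ cong₂ _+_ (zeroˡ v₂) (zeroˡ (- v₁)) ⟩
    0# + 0#                                           ≡⟨ +-identityʳ 0# ⟩
    0#                                                ∎
    where open ≡-Reasoning

  -- Incidence makes the determinant of `z` minus `x` and `v` vanish, so the displacement is a
  -- multiple of the nonzero `v`. This links the equation of a line to the parametrization in
  -- `IsNikodymSet`.
  on-joining⇒parametrized : ∀ x v v≢0 z → joining x v v≢0 on homogenize z →
                            ∃ λ t → x ⊕ t · v ≡ z
  on-joining⇒parametrized (x , y) (v₁ , v₂) v≢0 (x′ , y′) z-on =
    let t , tv₁≡ , tv₂≡ = proportional v≢0 cross in
    t , cong₂ _,_ (trans (cong (x +_) tv₁≡) (x+y-x≡y x x′))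
                  (trans (cong (y +_) tv₂≡) (x+y-x≡y y y′))
    where
    x+y-x≡y : ∀ x y → x + (y - x) ≡ y
    x+y-x≡y x y = trans (sym (+-assoc x y (- x))) (xyx⁻¹≈y x y)
    cross : (x′ - x) * v₂ ≡ (y′ - y) * v₁
    cross = x∙y⁻¹≈ε⇒x≈y _ _ (trans
      (cong ((x′ - x) * v₂ +_) (-‿distribʳ-* (y′ - y) v₁))
      (trans (sym (joining-dot x y v₁ v₂ x′ y′)) z-on))

  -- Blocking by Nikodym lines, and counting

  module _ (N : List Pair) (nikodym : IsNikodymSet N) where

    nikodym-line : Pair → Point
    nikodym-line x = let v , v≢0 , _ = nikodym x in joining x v v≢0

    -- A condition on each line separately, so that it survives the deletion of lines from a list.
    AtMostOneOff : Point → Set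
    AtMostOneOff P = ∀ x y → x ∉ N → y ∉ N →
      P on homogenize x → P on homogenize y → x ≡ y

    -- Only the base point can lie outside `N`: every other affine point of the line belongs to the
    -- punctured line, which `N` contains.
    nikodym-line-atMostOneOff : ∀ x → AtMostOneOff (nikodym-line x)
    nikodym-line-atMostOneOff x y z y∉N z∉N y-on z-on =
      trans (≡base y y∉N y-on) (sym (≡base z z∉N z-on))
      where
      v     = proj₁ (nikodym x)
      v≢0   = proj₁ (proj₂ (nikodym x))
      ray⊆N = proj₂ (proj₂ (nikodym x))

      ≡base : ∀ y → y ∉ N → nikodym-line x on homogenize y → y ≡ x
      ≡base y y∉N y-on =
        let t , x+tv≡y = on-joining⇒parametrized x v v≢0 y y-on
        in trans (sym x+tv≡y) (decidable-stable (≡-dec _≟_ _≟_ (x ⊕ t · v) x)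
             (subst (_∉ N) (sym x+tv≡y) y∉N ∘ ray⊆N t))

    -- It contains no affine point at all: incidence would give 1 = 0.
    line-at-infinity-atMostOneOff : AtMostOneOff line-at-infinity
    line-at-infinity-atMostOneOff (x , y) _ _ _ x-on _ = contradiction (begin
      1#                         ≡⟨ solve 2 (λ x y →
                                      con 1 := x :* con 0 :+ y :* con 0 :+ con 1 :* con 1)
                                      refl x y ⟩
      x * 0# + y * 0# + 1# * 1#  ≡⟨ x-on ⟩
      0#                         ∎) 1≢0
      where open ≡-Reasoning

    nikodym-lines : List Point
    nikodym-lines = line-at-infinity ∷ tabulate (nikodym-line ∘ Inverse.from pairs)

    nikodym-lines-atMostOneOff : All AtMostOneOff nikodym-lines
    nikodym-lines-atMostOneOff =
      line-at-infinity-atMostOneOff ∷ All.tabulate⁺ λ i → nikodym-line-atMostOneOff _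

    -- A dual line with `c` = 0 is a point at infinity; any other is the affine point (a/c, b/c),
    -- which lies on its own Nikodym line.
    nikodym-lines-blocking : IsBlockingSet nikodym-lines
    nikodym-lines-blocking ℓ@((a , b , c) , _) with c ≟ 0#
    ... | yes refl = here
      (solve 2 (λ a b → a :* con 0 :+ b :* con 0 :+ con 0 :* con 1 := con 0) refl a b)
    ... | no c≢0 with inverse c c≢0
    ...   | u , cu≡1 = there (Any.tabulate⁺ (Inverse.to pairs x)
              (subst (λ z → nikodym-line z on ℓ)
                     (sym (Inverse.strictlyInverseʳ pairs x)) x-on))
      where
      x : Pair
      x = u * a , u * b
      x-on : nikodym-line x on ℓ
      x-on = on-dehomogenize (nikodym-line x) ℓ cu≡1
               (base-on-joining x (proj₁ (nikodym x)) (proj₁ (proj₂ (nikodym x))))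

    -- The plane injects into the disjoint union of the positions in `N` and in `B`: points of `N`
    -- go to their own position, the others to that of a line of `B` through them.
    q²≤|N|+|B| : ∀ B → All AtMostOneOff B → IsBlockingSet B →
                 q ℕ.* q ℕ.≤ length N ℕ.+ length B
    q²≤|N|+|B| B atMostOne blocking =
      Fin.injective⇒≤ {f = Inverse.from Fin.+↔⊎ ∘ f ∘ Inverse.from pairs}
        λ eq → Injection.injective (↔⇒↣ (↔-sym pairs))
          (f-injective _ _ (Injection.injective (↔⇒↣ (↔-sym Fin.+↔⊎)) eq))
      where
      f : Pair → Fin (length N) ⊎ Fin (length B)
      f x with x ∈? N
      ... | yes x∈N = inj₁ (index x∈N)
      ... | no  x∉N = inj₂ (index (blocking (homogenize x)))

      f-injective : ∀ x y → f x ≡ f y → x ≡ y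
      f-injective x y eq with x ∈? N | y ∈? N
      ... | yes x∈N | yes y∈N = trans (Any.lookup-index x∈N)
        (trans (cong (lookup N) (inj₁-injective eq)) (sym (Any.lookup-index y∈N)))
      ... | no  x∉N | no  y∉N =
        All.lookup atMostOne (∈-lookup (index (blocking (homogenize y)))) x y x∉N y∉N
        (subst (λ i → lookup B i on homogenize x) (inj₂-injective eq)
               (Any.lookup-index (blocking (homogenize x))))
        (Any.lookup-index (blocking (homogenize y)))

proposition1p12 : (q : ℕ) → IsPrimePower q → (F : FiniteField q) →
    (b n : ℕ) → IsB F b → IsNikodym F n → b ≥ q ^ 2 ∸ n
proposition1p12 q _ F b n (_ , b-max) ((N , _ , nikodym , refl) , _) =
  decidable-stable (_ ℕ.≤? _) λ ≰b →
    irreducible-sublist (nikodym-lines F N nikodym)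
      (nikodym-lines-atMostOneOff F N nikodym) (nikodym-lines-blocking F N nikodym)
      λ (B , atMostOne , blocking , irreducible) → ≰b (begin
        -- `q ^ 2` computes to `q * (q * 1)`.
        q ^ 2 ∸ length N    ≡⟨ cong (λ m → q ℕ.* m ∸ length N) (ℕ.*-identityʳ q) ⟩
        q ℕ.* q ∸ length N  ≤⟨ ℕ.m≤n+o⇒m∸n≤o _ (length N)
                                 (q²≤|N|+|B| F N nikodym B atMostOne blocking) ⟩
        length B            ≤⟨ b-max _ (B , irreducible⇒unique F B blocking irreducible
                                     , irreducible⇒minimal F B blocking irreducible , refl) ⟩
        b                   ∎)
  where open ℕ.≤-Reasoning
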